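{- Let $Q$ be a directed set that is a countable union of $\omega_1$-directed sets. Then $\langle\mathcal U,\supseteq^*\rangle\not\equiv_T\omega\times Q$ for every nonprincipal ultrafilter $\mathcal U$ on $\omega$.
   Context: A quasiorder is a set with a reflexive transitive relation $\leq$. A quasiorder is $\kappa$-directed if every subset of size less than $\kappa$ has an upper bound in it; directed means $\omega$-directed. "$Q$ is a countable union of $\omega_1$-directed sets" means $Q=\bigcup_{n<\omega}Q_n$ where each $Q_n\subseteq Q$, with the order inherited from $Q$, is $\omega_1$-directed. The product $P\times Q$ of quasiorders is ordered coordinatewise: $\langle p_0,q_0\rangle\leq\langle p_1,q_1\rangle$ iff $p_0\leq p_1$ and $q_0\leq q_1$; $\omega$ has its usual order. For directed sets $P,Q$, a map $f\colon P\to Q$ is Tukey if the $f$-image of every unbounded subset of $P$ is unbounded in $Q$; $P\leq_T Q$ means a Tukey map $P\to Q$ exists; $P\equiv_T Q$ means $P\leq_T Q\leq_T P$. $A\supseteq^* B$ means $B\setminus A$ is finite. $\langle\mathcal U,\supseteq^*\rangle$ denotes $\mathcal U$ quasiordered so that $A\leq B$ iff $A\supseteq^* B$. -}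

module Defs where

open import Axiom.ExcludedMiddle using (ExcludedMiddle)
open import Data.Empty using (⊥-elim)
open import Data.Fin using (Fin; _↑ˡ_; _↑ʳ_; splitAt)
open import Data.Fin.Properties using (↑ˡ-injective; ↑ʳ-injective; splitAt-↑ˡ; splitAt-↑ʳ)
open import Data.Nat using (ℕ; _+_)
open import Data.Product using (Σ; ∃; ∃-syntax; _×_; _,_; proj₁; proj₂)
open import Data.Sum using (_⊎_; inj₁; inj₂)
open import Level using (Level; 0ℓ; suc; _⊔_; Setω)
open import Relation.Binary.Bundles using (Preorder)
import Relation.Binary.Construct.On as On
open import Relation.Binary.PropositionalEquality
  using (_≡_; refl; sym; trans; cong; isEquivalence)
open import Relation.Nullary using (¬_; Dec; yes; no)
open import Relation.Unary using (Pred; _∈_; _∉_; _⊆_; _≐_; _∩_; _∖_; ∁; ∅; U)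

private
  variable
    a b c ℓ ℓ₁ ℓ₂ ℓ₃ ℓ₄ s : Level

-- The ambient logic of the mathematics is classical.  Since existence is
-- expressed by Σ, decidability of every type also gives the choices that
-- classical arguments make.
Classical : Setω
Classical = ∀ {ℓ} → ExcludedMiddle ℓ

-- Under `Classical` every predicate, at any level, is equivalent to one in
-- Set₀, so 𝒫 A contains every subset of A up to extensional equality.
𝒫 : Set a → Set (a ⊔ suc 0ℓ)
𝒫 A = Pred A 0ℓ

-- |S| ≤ |B|.  The code of x may depend on the proof of x ∈ S, but codes of
-- distinct elements are distinct.
_≼_ : {A : Set a} → Pred A s → Set b → Set (a ⊔ s ⊔ b)
S ≼ B = Σ (∀ x → x ∈ S → B) λ f →
          ∀ x y (p : x ∈ S) (q : y ∈ S) → f x p ≡ f y q → x ≡ y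

Finite : {A : Set a} → Pred A s → Set (a ⊔ s)
Finite S = ∃[ n ] S ≼ Fin n

Countable : {A : Set a} → Pred A s → Set (a ⊔ s)
Countable S = S ≼ ℕ

-- Quasiorders are stdlib preorders.  Their setoid equality _≈_ plays no role
-- below: elements are compared by _≡_ or by _≲_ only.
module _ (P : Preorder c ℓ₁ ℓ₂) where
  open Preorder P

  Bounded : Pred Carrier s → Set (c ⊔ ℓ₂ ⊔ s)
  Bounded S = ∃[ u ] (∀ x → x ∈ S → x ≲ u)

  Unbounded : Pred Carrier s → Set (c ⊔ ℓ₂ ⊔ s)
  Unbounded S = ¬ Bounded S

  Directed : Set (c ⊔ ℓ₂ ⊔ suc 0ℓ)
  Directed = (S : 𝒫 Carrier) → Finite S → Bounded S

  -- Subsets of size less than ω₁ are the countable ones (finite included).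
  ω₁-Directed : Set (c ⊔ ℓ₂ ⊔ suc 0ℓ)
  ω₁-Directed = (S : 𝒫 Carrier) → Countable S → Bounded S

_↾_ : (P : Preorder c ℓ₁ ℓ₂) → Pred (Preorder.Carrier P) s → Preorder (c ⊔ s) ℓ₁ ℓ₂
P ↾ S = On.preorder P (proj₁ {B = λ x → x ∈ S})

CountableUnionOfω₁-Directed : Preorder c ℓ₁ ℓ₂ → Set (c ⊔ ℓ₂ ⊔ suc 0ℓ)
CountableUnionOfω₁-Directed Q =
  Σ (ℕ → 𝒫 (Preorder.Carrier Q)) λ Qₙ →
    (∀ q → ∃[ n ] q ∈ Qₙ n) × (∀ n → ω₁-Directed (Q ↾ Qₙ n))

Image : {A : Set a} {B : Set b} → (A → B) → Pred A s → Pred B (a ⊔ b ⊔ s)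
Image f S y = ∃[ x ] (x ∈ S × f x ≡ y)

module _ (P : Preorder a ℓ₁ ℓ₂) (Q : Preorder b ℓ₃ ℓ₄) where
  private
    module P = Preorder P
    module Q = Preorder Q

  IsTukey : (P.Carrier → Q.Carrier) → Set (a ⊔ b ⊔ ℓ₂ ⊔ ℓ₄ ⊔ suc 0ℓ)
  IsTukey f = (S : 𝒫 P.Carrier) → Unbounded P S → Unbounded Q (Image f S)

  _≤ᵀ_ : Set (a ⊔ b ⊔ ℓ₂ ⊔ ℓ₄ ⊔ suc 0ℓ)
  _≤ᵀ_ = ∃ IsTukey

_≡ᵀ_ : Preorder a ℓ₁ ℓ₂ → Preorder b ℓ₃ ℓ₄ → Set (a ⊔ b ⊔ ℓ₂ ⊔ ℓ₄ ⊔ suc 0ℓ)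
P ≡ᵀ Q = (P ≤ᵀ Q) × (Q ≤ᵀ P)

record IsUltrafilter {A : Set a} (𝒰 : 𝒫 (𝒫 A)) : Set (a ⊔ suc 0ℓ) where
  field
    full     : U ∈ 𝒰
    proper   : ∅ ∉ 𝒰
    upward   : ∀ X Y → X ∈ 𝒰 → X ⊆ Y → Y ∈ 𝒰
    ∩-closed : ∀ X Y → X ∈ 𝒰 → Y ∈ 𝒰 → (X ∩ Y) ∈ 𝒰
    ultra    : ∀ X → X ∈ 𝒰 ⊎ ∁ X ∈ 𝒰

Nonprincipal : {A : Set} → 𝒫 (𝒫 A) → Set₁
Nonprincipal 𝒰 = ¬ (∃[ x ] 𝒰 ≐ (λ X → x ∈ X))

_⊇*_ : 𝒫 ℕ → 𝒫 ℕ → Set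
A ⊇* B = Finite (B ∖ A)

⊇*-refl : ∀ {A} → A ⊇* A
⊇*-refl = 0 , (λ _ (p , ¬p) → ⊥-elim (¬p p)) , λ _ _ (p , ¬p) → ⊥-elim (¬p p)

⊇*-trans : Classical → ∀ {A B C} → A ⊇* B → B ⊇* C → A ⊇* C
⊇*-trans em {A} {B} {C} (m , f , f-inj) (n , g , g-inj) = m + n , h , h-inj
  where
  code : ∀ x → x ∈ (C ∖ A) → Dec (x ∈ B) → Fin (m + n)
  code x (x∈C , x∉A) (yes x∈B) = f x (x∈B , x∉A) ↑ˡ n
  code x (x∈C , x∉A) (no x∉B)  = m ↑ʳ g x (x∈C , x∉B)

  ↑ˡ≢↑ʳ : ∀ i j → ¬ (i ↑ˡ n ≡ m ↑ʳ j)
  ↑ˡ≢↑ʳ i j eq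
    with () ← trans (sym (splitAt-↑ˡ m i n)) (trans (cong (splitAt m) eq) (splitAt-↑ʳ m n j))

  code-inj : ∀ x y p q d e → code x p d ≡ code y q e → x ≡ y
  code-inj x y p q (yes _) (yes _) eq = f-inj x y _ _ (↑ˡ-injective n _ _ eq)
  code-inj x y p q (yes _) (no _)  eq = ⊥-elim (↑ˡ≢↑ʳ _ _ eq)
  code-inj x y p q (no _)  (yes _) eq = ⊥-elim (↑ˡ≢↑ʳ _ _ (sym eq))
  code-inj x y p q (no _)  (no _)  eq = g-inj x y _ _ (↑ʳ-injective m _ _ eq)

  h : ∀ x → x ∈ (C ∖ A) → Fin (m + n)
  h x p = code x p em

  h-inj : ∀ x y p q → h x p ≡ h y q → x ≡ y
  h-inj x y p q = code-inj x y p q em em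

⊇*-preorder : Classical → Preorder (suc 0ℓ) (suc 0ℓ) 0ℓ
⊇*-preorder em = record
  { Carrier    = 𝒫 ℕ
  ; _≈_        = _≡_
  ; _≲_        = _⊇*_
  ; isPreorder = record
    { isEquivalence = isEquivalence
    ; reflexive     = λ { refl → ⊇*-refl }
    ; trans         = λ {A} {B} {C} → ⊇*-trans em {A} {B} {C}
    }
  }

-- ⟨𝒰, ⊇*⟩.  Excluded middle enters only through transitivity of ⊇*.
⟨_,⊇*⟩ : 𝒫 (𝒫 ℕ) → Classical → Preorder (suc 0ℓ) (suc 0ℓ) 0ℓ
⟨ 𝒰 ,⊇*⟩ em = ⊇*-preorder em ↾ 𝒰

{-# OPTIONS --safe #-}
-- Write f : 𝒰 → ω × Q and g : ω × Q → 𝒰 for the Tukey maps.  The images under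
-- g of the pairs ⟨n , q₀⟩ form a countable subset of 𝒰 without a
-- pseudo-intersection in 𝒰, so 𝒰 is not a P-point: some p : ω → ω is neither
-- bounded nor finite-to-one on any member of 𝒰.  If B ∈ 𝒰 is almost contained
-- in every p⁻¹ X with X in some family, then the set D of those n whose fibre
-- meets B infinitely often is contained in every such X outright, and p⁻¹ D ∈ 𝒰.
-- Thus almost containment in 𝒰 becomes true containment in W = p(𝒰).
--
-- Now f splits W into countably many pieces, according to the first coordinate
-- and to the Qₘ containing the second.  Countable subsets of a piece have
-- bounded f-image, hence a lower bound in W.  The intersection of any family
-- of subsets of ω is already the intersection of a countable subfamily, so the
-- whole piece has a lower bound in W.  Hence W is countably generated, which a
-- diagonal construction refutes.
module Submission where

open import Defs
open import Data.Empty using (⊥-elim)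
open import Data.Nat using (ℕ; zero; suc; _⊔_; _≤_; _<_; s≤s)
open import Data.Nat.Induction using (<-rec)
open import Data.Nat.Properties
  using (≤-preorder; ≤-reflexive; <-trans; <-irrefl; <-cmp; m<1+n⇒m<n∨m≡n;
         ≮⇒≥; m≤m⊔n; m≤n⊔m)
open import Data.Product using (∃; ∃-syntax; _×_; _,_; proj₁; proj₂)
open import Data.Product.Relation.Binary.Pointwise.NonDependent using (×-preorder)
open import Data.Sum using (_⊎_; inj₁; inj₂; [_,_]′)
open import Function using (_∘_; id)
open import Relation.Binary.Bundles using (Preorder)
open import Relation.Binary.Definitions using (tri<; tri≈; tri>)
open import Relation.Binary.PropositionalEquality using (_≡_; _≢_; refl; sym; trans; cong)
open import Relation.Nullary using (¬_; yes; no)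
open import Relation.Nullary.Decidable using (True; toWitness; fromWitness; decidable-stable)
open import Relation.Unary using (Pred; _∈_; _∉_; _⊆_; _∩_; ∁; ∅; U; _⊢_)

-- Finite sets of naturals and splitting sets.

⋂< : ℕ → (ℕ → 𝒫 ℕ) → 𝒫 ℕ
⋂< n X x = ∀ i → i < n → x ∈ X i

⋃< : ℕ → (ℕ → 𝒫 ℕ) → 𝒫 ℕ
⋃< n X x = ∃[ i ] (i < n × x ∈ X i)

Fibre : (ℕ → ℕ) → ℕ → 𝒫 ℕ
Fibre p n x = p x ≡ n

≼-⊆ : ∀ {a s t b} {A : Set a} {S : Pred A s} {T : Pred A t} {B : Set b} →
      S ⊆ T → T ≼ B → S ≼ B
≼-⊆ S⊆T (f , f-inj) = (λ x p → f x (S⊆T p)) , λ x y p q → f-inj x y (S⊆T p) (S⊆T q)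

Finite-⊆ : ∀ {S T : 𝒫 ℕ} → S ⊆ T → Finite T → Finite S
Finite-⊆ S⊆T (n , T≼n) = n , ≼-⊆ S⊆T T≼n

Finite-∅ : Finite {A = ℕ} ∅
Finite-∅ = 0 , (λ _ ()) , λ _ _ ()

-- x i < y i are chosen in C i, above all earlier choices; X collects the x i.
splitting-set : (C : ℕ → 𝒫 ℕ) → (∀ n b → ∃[ x ] (b ≤ x × x ∈ C n)) →
                ∃[ X ] (∀ n → ¬ C n ⊆ X × ¬ C n ⊆ ∁ X)
splitting-set C unbounded = X , λ n →
    (λ C⊆X → y∉X n (C⊆X (proj₂ (proj₂ (y-spec n)))))
  , (λ C⊆∁X → C⊆∁X (proj₂ (proj₂ (x-spec n))) (n , refl))
  where
  start : ℕ → ℕ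
  start zero    = 0
  -- The number under the outer `suc` is `y n`, written out because `y` is defined from `start`.
  start (suc n) = suc (proj₁ (unbounded n (suc (proj₁ (unbounded n (start n))))))

  x-spec : ∀ n → ∃[ x ] (start n ≤ x × x ∈ C n)
  x-spec n = unbounded n (start n)

  x : ℕ → ℕ
  x = proj₁ ∘ x-spec

  y-spec : ∀ n → ∃[ y ] (x n < y × y ∈ C n)
  y-spec n = unbounded n (suc (x n))

  y : ℕ → ℕ
  y = proj₁ ∘ y-spec

  X : 𝒫 ℕ
  X k = ∃[ i ] x i ≡ k

  x<y : ∀ n → x n < y n
  x<y n = proj₁ (proj₂ (y-spec n))

  y<x : ∀ {m n} → m < n → y m < x n
  y<x {m} {suc n} m<1+n with m<1+n⇒m<n∨m≡n m<1+n
  ... | inj₁ m<n  = <-trans (y<x m<n) (<-trans (x<y n) (proj₁ (proj₂ (x-spec (suc n)))))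
  ... | inj₂ refl = proj₁ (proj₂ (x-spec (suc n)))

  y∉X : ∀ n → y n ∉ X
  y∉X n (i , xᵢ≡yₙ) with <-cmp i n
  ... | tri< i<n _ _  = <-irrefl xᵢ≡yₙ (<-trans (x<y i) (<-trans (y<x i<n) (x<y n)))
  ... | tri≈ _ refl _ = <-irrefl xᵢ≡yₙ (x<y n)
  ... | tri> _ _ n<i  = <-irrefl (sym xᵢ≡yₙ) (y<x n<i)

module _ (em : Classical) where

  by-contradiction : ∀ {a} {A : Set a} → ¬ ¬ A → A
  by-contradiction = decidable-stable em

  least : (P : 𝒫 ℕ) → ∀ n → n ∈ P → ∃[ m ] (m ∈ P × (∀ i → i ∈ P → m ≤ i))
  least P = <-rec (λ n → n ∈ P → _) step
    where
    step : ∀ n → (∀ {i} → i < n → i ∈ P → ∃[ m ] (m ∈ P × (∀ k → k ∈ P → m ≤ k))) →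
           n ∈ P → ∃[ m ] (m ∈ P × (∀ k → k ∈ P → m ≤ k))
    step n rec n∈P with em {P = ∃[ i ] (i < n × i ∈ P)}
    ... | yes (i , i<n , i∈P) = rec i<n i∈P
    ... | no  ¬smaller = n , n∈P , λ i i∈P → ≮⇒≥ λ i<n → ¬smaller (i , i<n , i∈P)

  -- S ∪ T is finite because ∅ ⊇* T ⊇* S ∪ T.
  Finite-⊎ : ∀ {R S T : 𝒫 ℕ} → (∀ {x} → x ∈ R → x ∈ S ⊎ x ∈ T) →
             Finite S → Finite T → Finite R
  Finite-⊎ {R} {S} {T} R⊆S∪T finS finT =
    Finite-⊆ (λ x∈R → x∈R , λ ())
      (⊇*-trans em {∅} {T} {R} (Finite-⊆ proj₁ finT)
        (Finite-⊆ (λ { (x∈R , x∉T) → [ id , ⊥-elim ∘ x∉T ]′ (R⊆S∪T x∈R) }) finS))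

  Finite-⋃< : ∀ n (S : ℕ → 𝒫 ℕ) → (∀ i → Finite (S i)) → Finite (⋃< n S)
  Finite-⋃< zero    S fin = Finite-⊆ (λ ()) Finite-∅
  Finite-⋃< (suc n) S fin = Finite-⊎ split (Finite-⋃< n S fin) (fin n)
    where
    split : ∀ {x} → x ∈ ⋃< (suc n) S → x ∈ ⋃< n S ⊎ x ∈ S n
    split (i , i<1+n , x∈Sᵢ) with m<1+n⇒m<n∨m≡n i<1+n
    ... | inj₁ i<n  = inj₁ (i , i<n , x∈Sᵢ)
    ... | inj₂ refl = inj₂ x∈Sᵢ

  -- `True em` brings the range down to Set₀.
  Range : ∀ {a} {A : Set a} → (ℕ → A) → 𝒫 A
  Range F x = True (em {P = ∃[ i ] F i ≡ x})

  ω₁-Directed⇒sequences-bounded :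
    ∀ {c ℓ₁ ℓ₂} (P : Preorder c ℓ₁ ℓ₂) → ω₁-Directed P →
    (F : ℕ → Preorder.Carrier P) → ∃[ u ] (∀ i → Preorder._≲_ P (F i) u)
  ω₁-Directed⇒sequences-bounded P directed F =
    let u , F≲u = directed (Range F) countable
    in u , λ i → F≲u (F i) (fromWitness (i , refl))
    where
    countable : Countable (Range F)
    countable = (λ _ → proj₁ ∘ toWitness) , λ _ _ x∈F y∈F i≡j →
      trans (sym (proj₂ (toWitness x∈F))) (trans (cong F i≡j) (proj₂ (toWitness y∈F)))

  -- The contrapositive of the Tukey property for `Range F`, whose image lies below `v`.
  Tukey-reflects-sequence-bounds :
    ∀ {a b ℓ₁ ℓ₂ ℓ₃ ℓ₄} (P : Preorder a ℓ₁ ℓ₂) (Q : Preorder b ℓ₃ ℓ₄) →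
    (f : Preorder.Carrier P → Preorder.Carrier Q) → IsTukey P Q f →
    (F : ℕ → Preorder.Carrier P) →
    ∃[ v ] (∀ i → Preorder._≲_ Q (f (F i)) v) → ∃[ u ] (∀ i → Preorder._≲_ P (F i) u)
  Tukey-reflects-sequence-bounds P Q f tukey F (v , fF≲v) =
    let u , F≲u = by-contradiction λ unbounded → tukey (Range F) unbounded (v , image≲v)
    in u , λ i → F≲u (F i) (fromWitness (i , refl))
    where
    image≲v : ∀ y → y ∈ Image f (Range F) → Preorder._≲_ Q y v
    image≲v _ (x , x∈F , refl) with i , refl ← toWitness {a? = em} x∈F = fF≲v i

  -- Ultrafilters and maps witnessing the failure of the P-point property.

  module _ {𝒰 : 𝒫 (𝒫 ℕ)} (ultrafilter : IsUltrafilter 𝒰) where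
    open IsUltrafilter ultrafilter

    inhabited : ∀ X → X ∈ 𝒰 → ∃[ x ] x ∈ X
    inhabited X X∈𝒰 = by-contradiction λ empty →
      proper (upward X ∅ X∈𝒰 λ x∈X → empty (_ , x∈X))

    ⋂<-closed : ∀ n (X : ℕ → 𝒫 ℕ) → (∀ i → X i ∈ 𝒰) → ⋂< n X ∈ 𝒰
    ⋂<-closed zero    X X∈𝒰 = upward U _ full λ _ _ ()
    ⋂<-closed (suc n) X X∈𝒰 =
      upward (⋂< n X ∩ X n) _ (∩-closed _ _ (⋂<-closed n X X∈𝒰) (X∈𝒰 n)) join
      where
      join : ⋂< n X ∩ X n ⊆ ⋂< (suc n) X
      join (x∈⋂ , x∈Xₙ) i i<1+n with m<1+n⇒m<n∨m≡n i<1+n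
      ... | inj₁ i<n  = x∈⋂ i i<n
      ... | inj₂ refl = x∈Xₙ

    cosingleton-∈ : Nonprincipal 𝒰 → ∀ n → (_≢ n) ∈ 𝒰
    cosingleton-∈ nonprincipal n with ultra (_≡ n)
    ... | inj₂ ≢n∈𝒰 = ≢n∈𝒰
    ... | inj₁ ≡n∈𝒰 = ⊥-elim (nonprincipal (n , n∈ , λ n∈X → upward _ _ ≡n∈𝒰 λ { refl → n∈X }))
      where
      n∈ : ∀ {X} → X ∈ 𝒰 → n ∈ X
      n∈ X∈𝒰 with _ , x∈X , refl ← inhabited _ (∩-closed _ _ X∈𝒰 ≡n∈𝒰) = x∈X

    -- For an ultrafilter, `tails-∈` says that `p` is bounded on no member.
    record NonPPointMap (p : ℕ → ℕ) : Set₁ where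
      field
        tails-∈           : ∀ n → p ⊢ (n ≤_) ∈ 𝒰
        not-finite-to-one : ∀ B → B ∈ 𝒰 → ¬ (∀ n → Finite (B ∩ Fibre p n))

    -- Removing n from A n makes the intersection of all A n empty, so that p is total.
    no-pseudo-intersection⇒NonPPointMap :
      Nonprincipal 𝒰 → (A : ℕ → 𝒫 ℕ) → (∀ n → A n ∈ 𝒰) →
      (∀ B → B ∈ 𝒰 → ¬ (∀ n → A n ⊇* B)) → ∃ NonPPointMap
    no-pseudo-intersection⇒NonPPointMap nonprincipal A A∈𝒰 ¬bounded = p , record
      { tails-∈ = λ n → upward (⋂< n A′) _ (⋂<-closed n A′ A′∈𝒰) λ x∈⋂ →
          ≮⇒≥ λ px<n → proj₁ (proj₂ (p-spec _)) (x∈⋂ _ px<n)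
      -- Points of `B` outside `A n` have `p`-value at most `n`, so `suc n` fibres cover them.
      ; not-finite-to-one = λ B B∈𝒰 fin → ¬bounded B B∈𝒰 λ n →
          Finite-⊆ (λ { (x∈B , x∉A) →
              _ , s≤s (proj₂ (proj₂ (p-spec _)) n (x∉A ∘ proj₁)) , x∈B , refl })
            (Finite-⋃< (suc n) (λ i → B ∩ Fibre p i) fin)
      }
      where
      A′ : ℕ → 𝒫 ℕ
      A′ n = A n ∩ (_≢ n)

      A′∈𝒰 : ∀ n → A′ n ∈ 𝒰
      A′∈𝒰 n = ∩-closed _ _ (A∈𝒰 n) (cosingleton-∈ nonprincipal n)

      p-spec : ∀ x → ∃[ m ] (x ∉ A′ m × (∀ i → x ∉ A′ i → m ≤ i))
      -- The search can start at `x`, because `A′ x` omits `x`.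
      p-spec x = least (λ n → x ∉ A′ n) x λ x∈A′ → proj₂ x∈A′ refl

      p : ℕ → ℕ
      p = proj₁ ∘ p-spec

    -- The image of the ultrafilter under `p`.

    module _ {p : ℕ → ℕ} (nonPPoint : NonPPointMap p) where
      open NonPPointMap nonPPoint

      InfiniteFibres : 𝒫 ℕ → 𝒫 ℕ
      InfiniteFibres B n = ¬ Finite (B ∩ Fibre p n)

      -- Otherwise the part of `B` lying over the finite fibres is a member of `𝒰` on which `p` is
      -- finite-to-one.
      InfiniteFibres-∈ : ∀ B → B ∈ 𝒰 → p ⊢ InfiniteFibres B ∈ 𝒰
      InfiniteFibres-∈ B B∈𝒰 with ultra (p ⊢ InfiniteFibres B)
      ... | inj₁ D∈𝒰  = D∈𝒰
      ... | inj₂ ∁D∈𝒰 = ⊥-elim (not-finite-to-one E (∩-closed _ _ B∈𝒰 ∁D∈𝒰) finite-fibre)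
        where
        E : 𝒫 ℕ
        E = B ∩ ∁ (p ⊢ InfiniteFibres B)

        finite-fibre : ∀ n → Finite (E ∩ Fibre p n)
        finite-fibre n = by-contradiction λ infinite → infinite
          -- An infinite fibre of `E` would make that of `B` infinite too, but `E` has no points
          -- over such an `n`.
          (Finite-⊆ (λ { ((_ , x∉D) , refl) → ⊥-elim
              (x∉D λ fin → infinite (Finite-⊆ (λ { ((x∈B , _) , eq) → x∈B , eq }) fin)) })
            Finite-∅)

      -- If `n` is not in `X`, the whole fibre of `B` over `n` is among the finitely many points of
      -- `B` outside `p ⊢ X`.
      InfiniteFibres-⊆ : ∀ B X → (p ⊢ X) ⊇* B → InfiniteFibres B ⊆ X
      InfiniteFibres-⊆ B X almost infinite = by-contradiction λ n∉X →
        infinite (Finite-⊆ (λ { (x∈B , refl) → x∈B , n∉X }) almost)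

      -- A set that splits every `C n` contains no generator, nor does its complement, yet one of
      -- the two is in the image ultrafilter.
      not-countably-generated :
        (D : ℕ → ℕ → 𝒫 ℕ) → (∀ j m → p ⊢ D j m ∈ 𝒰) →
        ¬ (∀ X → p ⊢ X ∈ 𝒰 → ∃[ j ] ∃[ m ] D j m ⊆ X)
      not-countably-generated D D∈𝒰 generates =
        [ refute X (proj₁ ∘ splits) , refute (∁ X) (proj₂ ∘ splits) ]′ (ultra (p ⊢ X))
        where
        C : ℕ → 𝒫 ℕ
        -- Square stages avoid coding pairs: `C (j ⊔ m)` is contained in `D j m`.
        C n = ⋂< (suc n) λ j → ⋂< (suc n) (D j)

        C∈𝒰 : ∀ n → p ⊢ C n ∈ 𝒰
        C∈𝒰 n = ⋂<-closed (suc n) (λ j → p ⊢ ⋂< (suc n) (D j)) λ j →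
                 ⋂<-closed (suc n) (λ m → p ⊢ D j m) (D∈𝒰 j)

        C-unbounded : ∀ n b → ∃[ k ] (b ≤ k × k ∈ C n)
        C-unbounded n b =
          let x , b≤px , px∈C = inhabited _ (∩-closed _ _ (tails-∈ b) (C∈𝒰 n))
          in p x , b≤px , px∈C

        X : 𝒫 ℕ
        X = proj₁ (splitting-set C C-unbounded)

        splits : ∀ n → ¬ C n ⊆ X × ¬ C n ⊆ ∁ X
        splits = proj₂ (splitting-set C C-unbounded)

        refute : ∀ Z → (∀ n → ¬ C n ⊆ Z) → ¬ (p ⊢ Z ∈ 𝒰)
        refute Z C⊈Z Z∈𝒰 =
          let j , m , D⊆Z = generates Z Z∈𝒰
          in C⊈Z (j ⊔ m) λ k∈C → D⊆Z (k∈C j (s≤s (m≤m⊔n j m)) m (s≤s (m≤n⊔m j m)))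

  -- Member n misses n whenever some member of 𝓕 does.
  countable-subfamily :
    ∀ {s} (𝓕 : Pred (𝒫 ℕ) s) → ∃[ X ] X ∈ 𝓕 →
    ∃[ G ] ((∀ i → G i ∈ 𝓕) × (∀ n → (∀ i → n ∈ G i) → ∀ X → X ∈ 𝓕 → n ∈ X))
  countable-subfamily 𝓕 (X₀ , X₀∈𝓕) =
      proj₁ ∘ choice , proj₁ ∘ proj₂ ∘ choice , λ n n∈G → proj₂ (proj₂ (choice n)) (n∈G n)
    where
    choice : ∀ n → ∃[ Y ] (Y ∈ 𝓕 × (n ∈ Y → ∀ X → X ∈ 𝓕 → n ∈ X))
    choice n with em {P = ∃[ X ] (X ∈ 𝓕 × n ∉ X)}
    ... | yes (Y , Y∈𝓕 , n∉Y) = Y , Y∈𝓕 , ⊥-elim ∘ n∉Y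
    ... | no  ¬missed = X₀ , X₀∈𝓕 , λ _ X X∈𝓕 → by-contradiction λ n∉X → ¬missed (X , X∈𝓕 , n∉X)

theorem3p13 : (em : Classical) →
    ∀ {c ℓ₁ ℓ₂} (Q : Preorder c ℓ₁ ℓ₂) →
    Directed Q →
    CountableUnionOfω₁-Directed Q →
    (𝒰 : 𝒫 (𝒫 ℕ)) → IsUltrafilter 𝒰 → Nonprincipal 𝒰 →
    ¬ (⟨ 𝒰 ,⊇*⟩ em ≡ᵀ ×-preorder ≤-preorder Q)
theorem3p13 em Q directed (Qₙ , cover , Qₙ-directed) 𝒰 ultrafilter nonprincipal
  ((f , f-tukey) , (g , g-tukey)) =
  not-countably-generated em ultrafilter nonPPoint
    (λ j m → proj₁ (piece-bounded j m)) (λ j m → proj₁ (proj₂ (piece-bounded j m)))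
    λ X X∈𝒰 →
      let j , q = f (p ⊢ X , X∈𝒰)
          m , q∈Qₘ = cover q
      in j , m , proj₂ (proj₂ (piece-bounded j m)) X (X∈𝒰 , refl , q∈Qₘ)
  where
  open IsUltrafilter ultrafilter

  q₀ : Preorder.Carrier Q
  -- A bound of the empty set supplies an element.
  q₀ = proj₁ (directed ∅ (0 , (λ _ ()) , λ _ _ ()))

  nonPPointMap : ∃ (NonPPointMap em ultrafilter)
  nonPPointMap = no-pseudo-intersection⇒NonPPointMap em ultrafilter nonprincipal
    (λ n → proj₁ (g (n , q₀))) (λ n → proj₂ (g (n , q₀)))
    λ B B∈𝒰 bound →
      -- A pseudo-intersection `B` would give a bound for all pairs `(n , q₀)`, hence some `N` above
      -- every natural number.
      let (N , _) , bounded = Tukey-reflects-sequence-bounds em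
            (×-preorder ≤-preorder Q) (⟨ 𝒰 ,⊇*⟩ em) g g-tukey (_, q₀) ((B , B∈𝒰) , bound)
      in <-irrefl refl (proj₁ (bounded (suc N)))

  p : ℕ → ℕ
  p = proj₁ nonPPointMap

  nonPPoint : NonPPointMap em ultrafilter p
  nonPPoint = proj₂ nonPPointMap

  -- The argument of `f` includes a membership proof, so a piece records one.
  Piece : ℕ → ℕ → 𝒫 (𝒫 ℕ)
  Piece j m X = ∃[ X∈𝒰 ] (proj₁ (f (p ⊢ X , X∈𝒰)) ≡ j × proj₂ (f (p ⊢ X , X∈𝒰)) ∈ Qₙ m)

  piece-bounded : ∀ j m → ∃[ D ] (p ⊢ D ∈ 𝒰 × (∀ X → X ∈ Piece j m → D ⊆ X))
  piece-bounded j m with em {P = ∃[ X ] X ∈ Piece j m}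
  -- An empty piece gets the trivial lower bound `U`.
  ... | no  empty = U , full , λ X X∈ → ⊥-elim (empty (X , X∈))
  ... | yes nonempty =
    InfiniteFibres em ultrafilter nonPPoint B
    , InfiniteFibres-∈ em ultrafilter nonPPoint B B∈𝒰
    , λ X X∈ {n} n∈D → ⋂G⊆ n
        (λ i → InfiniteFibres-⊆ em ultrafilter nonPPoint B (G i) (G⊇*B i) n∈D) X X∈
    where
    subfamily = countable-subfamily em (Piece j m) nonempty
    G   = proj₁ subfamily
    G∈  = proj₁ (proj₂ subfamily)
    ⋂G⊆ = proj₂ (proj₂ subfamily)

    F : ℕ → Preorder.Carrier (⟨ 𝒰 ,⊇*⟩ em)
    F i = p ⊢ G i , proj₁ (G∈ i)

    image-bounded : ∃[ v ] (∀ i → Preorder._≲_ (×-preorder ≤-preorder Q) (f (F i)) v)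
    image-bounded =
      let (u , _) , ≲u = ω₁-Directed⇒sequences-bounded em (Q ↾ Qₙ m) (Qₙ-directed m)
            λ i → proj₂ (f (F i)) , proj₂ (proj₂ (G∈ i))
      -- On the piece the first coordinate is constantly `j`.
      in (j , u) , λ i → ≤-reflexive (proj₁ (proj₂ (G∈ i))) , ≲u i

    bound = Tukey-reflects-sequence-bounds em
      (⟨ 𝒰 ,⊇*⟩ em) (×-preorder ≤-preorder Q) f f-tukey F image-bounded

    B : 𝒫 ℕ
    B = proj₁ (proj₁ bound)

    B∈𝒰 : B ∈ 𝒰
    B∈𝒰 = proj₂ (proj₁ bound)

    G⊇*B : ∀ i → (p ⊢ G i) ⊇* B
    G⊇*B = proj₂ bound
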